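{- Let $\mathbb{V}$ be the Viro (triangle) hyperfield, let $f:\mathbb{C}\to\mathbb{V}$, $f(z)=|z|$, and let $\overline{p}(T)=T^3+1.6\,T^2+0.512$, a polynomial over $\mathbb{V}$. Then $\mathrm{mult}_{0.8}(\overline{p})=3$, and for every polynomial $p\in\mathbb{C}[T]$ corresponding to $\overline{p}$ with respect to $f$ (that is, $p(T)=c_3T^3+c_2T^2+c_1T+c_0$ with $|c_3|=1$, $|c_2|=1.6$, $c_1=0$, $|c_0|=0.512$) one has $$\mathrm{mult}_{0.8}(\overline{p})=3>2\geq\sum_{b\in\mathbb{C},\ |b|=0.8}\mathrm{mult}_b(p).$$ In particular, the inequality $\mathrm{mult}_a(\overline{p})\ge\sum_{b\in f^{ -1}(a)}\mathrm{mult}_b(p)$ is not sharp under $f:\mathbb{C}\to\mathbb{V}$: for this $\overline{p}$ and $a=0.8$, no corresponding polynomial $p$ attains equality.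
   Context: The Viro hyperfield $\mathbb{V}$ is the set $\mathbb{R}_{\ge 0}$ with the usual multiplication and the hyperaddition $x\boxplus y=\{z\in\mathbb{R}_{\ge0}: |x-y|\le z\le x+y\}$; every element is its own hyperinverse, $-x=x$. For subsets, $A\boxplus B=\bigcup_{a\in A,b\in B}a\boxplus b$, and iterated hypersums are defined accordingly ($\boxplus$ is associative and commutative). A polynomial over a hyperfield $\mathbb{F}$ is a formal expression $p(T)=c_nT^n+\cdots+c_1T+c_0$ with $c_i\in\mathbb{F}$, $c_n\ne0$ (degree $n$). For polynomials $p=\sum_{k\le n} c_kT^k$ and $q=\sum_{l\le m} d_lT^l$, the product $p\boxdot q$ is the set of all $\sum_{i=0}^{n+m}e_iT^i$ with $e_i\in\boxplus_{k+l=i}c_kd_l$ for every $i$. An element $a\in\mathbb{F}$ is a root of $p$ if $0\in c_na^n\boxplus\cdots\boxplus c_1a\boxplus c_0$ (equivalently, $p\in(T-a)\boxdot q$ for some polynomial $q$ over $\mathbb{F}$). The multiplicity is defined recursively: $\mathrm{mult}_a(p)=0$ if $a$ is not a root of $p$, and otherwise $\mathrm{mult}_a(p)=1+\max\{\mathrm{mult}_a(q): p\in(T-a)\boxdot q\}$. For a field (viewed as a hyperfield with $x\boxplus y=\{x+y\}$) this is the usual multiplicity of a root. -}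

module Defs where

open import Level using (0ℓ)
open import Algebra.Bundles using (CommutativeRing; RawRing)
open import Algebra.Core using (Op₁; Op₂)
open import Algebra.Structures using (IsCommutativeRing)
open import Data.Empty using (⊥)
open import Data.Fin.Base using (Fin; fromℕ; toℕ)
open import Data.List.Base as List using (List; []; _∷_; allFin; cartesianProduct; filter)
import Data.List.Membership.Setoid as Membership
open import Data.List.Relation.Binary.Pointwise.Base using (Pointwise)
open import Data.List.Relation.Unary.All using (All)
import Data.List.Relation.Unary.Unique.Setoid as Uniqueness
open import Data.Nat.Base as ℕ using (ℕ; zero; suc)
open import Data.Nat.ListAction using (sum)
import Data.Nat.Properties as ℕ
open import Data.Product using (Σ; ∃; _×_; _,_; proj₁; proj₂)
open import Data.Product.Relation.Binary.Pointwise.NonDependent using (×-setoid)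
open import Data.Sum.Base using (inj₁; inj₂)
import Data.Vec.Functional as Vector
open Vector using (Vector)
open import Relation.Binary.Bundles using (DecTotalOrder; Setoid)
open import Relation.Binary.Core using (Rel)
open import Relation.Binary.PropositionalEquality.Core using (_≡_)
open import Relation.Binary.Structures using (IsDecTotalOrder)
open import Relation.Nullary.Decidable.Core using (yes; no)
open import Relation.Nullary.Negation.Core using (¬_; contradiction)
open import Relation.Unary using (Pred; _∈_; Satisfiable)

-- Maximum of a set of natural numbers.

IsMax : Pred ℕ 0ℓ → ℕ → Set
IsMax S k = k ∈ S × (∀ m → m ∈ S → m ℕ.≤ k)

------------------------------------------------------------------------
-- Polynomials and multiplicities over a hyperfield.  None of the
-- definitions depends on the hyperfield axioms, so they are given for the
-- bare signature, in the manner of `RawRing`.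

record RawHyperfield : Set₁ where
  infix  8 -_
  infixl 7 _*_
  infixl 6 _⊞_
  infix  4 _≈_
  field
    Carrier : Set
    _≈_     : Rel Carrier 0ℓ
    _⊞_     : Carrier → Carrier → Pred Carrier 0ℓ
    _*_     : Op₂ Carrier
    -_      : Op₁ Carrier
    0# 1#   : Carrier

  infixr 8 _^_
  _^_ : Carrier → ℕ → Carrier
  x ^ zero  = 1#
  x ^ suc n = x * x ^ n

  -- x ⊞ A = ⋃ { x ⊞ y ∣ y ∈ A }; the empty hypersum is { 0# }.
  hypersum : List Carrier → Pred Carrier 0ℓ
  hypersum []       z = z ≈ 0#
  hypersum (x ∷ xs) z = ∃ λ y → y ∈ hypersum xs × z ∈ x ⊞ y

-- A field, viewed as a hyperfield.

fromRawRing : RawRing 0ℓ 0ℓ → RawHyperfield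
fromRawRing R = record
  { Carrier = Carrier ; _≈_ = _≈_
  ; _⊞_ = λ x y z → z ≈ x + y
  ; _*_ = _*_ ; -_ = -_ ; 0# = 0# ; 1# = 1#
  } where open RawRing R

module Polynomial (F : RawHyperfield) where
  open RawHyperfield F

  -- c₀, c₁, …, cₙ in this order, i.e. lowest degree first.
  Coeffs : ℕ → Set
  Coeffs n = Vector Carrier (suc n)

  -- Polynomials of degree n.
  record Poly (n : ℕ) : Set where
    field
      coeff   : Coeffs n
      leading : ¬ coeff (fromℕ n) ≈ 0#
  open Poly public

  -- The (c k * d l) with k + l = i.
  convolution : ∀ {n m} → Coeffs n → Coeffs m → ℕ → List Carrier
  convolution c d i =
    List.map (λ (k , l) → c k * d l)
      (filter (λ (k , l) → toℕ k ℕ.+ toℕ l ℕ.≟ i)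
        (cartesianProduct (allFin _) (allFin _)))

  infixl 7 _⊡_
  _⊡_ : ∀ {n m} → Coeffs n → Coeffs m → Pred (Coeffs (n ℕ.+ m)) 0ℓ
  (c ⊡ d) e = ∀ i → e i ∈ hypersum (convolution c d (toℕ i))

  infix 8 T-_
  T-_ : Carrier → Coeffs 1
  T- a = (- a) Vector.∷ 1# Vector.∷ Vector.[]

  IsRoot : ∀ {n} → Carrier → Poly n → Set
  IsRoot a p = 0# ∈ hypersum (List.tabulate λ i → coeff p i * a ^ toℕ i)

  -- IsMult a p k says that mult_a(p) = k.  Multiplicity is defined as a
  -- relation because the maximum ranges over a possibly infinite set.  A
  -- q with p ∈ (T - a) ⊡ q has degree one less than p, so there is none
  -- when p is constant; a constant polynomial has no roots anyway.
  IsMult : ∀ {n} → Carrier → Poly n → ℕ → Set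
  IsMult {n}     a p zero    = ¬ IsRoot a p
  IsMult {zero}  a p (suc k) = ⊥
  IsMult {suc n} a p (suc k) = IsRoot a p × IsMax
    (λ m → ∃ λ (q : Poly n) → coeff p ∈ (T- a) ⊡ coeff q × IsMult a q m) k

------------------------------------------------------------------------
-- The field of real numbers, characterised axiomatically: classically, a
-- (Dedekind) complete ordered field is unique up to unique isomorphism.

record CompleteOrderedField : Set₁ where
  infix  9 _⁻¹
  infix  8 -_
  infixl 7 _*_
  infixl 6 _+_
  infix  4 _≈_ _≤_
  field
    Carrier : Set
    _≈_ _≤_ : Rel Carrier 0ℓ
    _+_ _*_ : Op₂ Carrier
    -_ _⁻¹  : Op₁ Carrier
    0# 1#   : Carrier

    isCommutativeRing : IsCommutativeRing _≈_ _+_ _*_ -_ 0# 1#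
    1≉0               : ¬ 1# ≈ 0#
    -- The value of 0# ⁻¹ is unspecified.
    *-inverseʳ        : ∀ {x} → ¬ x ≈ 0# → x * x ⁻¹ ≈ 1#

    isDecTotalOrder   : IsDecTotalOrder _≈_ _≤_
    +-monoʳ-≤         : ∀ x {y z} → y ≤ z → x + y ≤ x + z
    *-nonneg          : ∀ {x y} → 0# ≤ x → 0# ≤ y → 0# ≤ x * y

  IsUpperBound : Pred Carrier 0ℓ → Pred Carrier 0ℓ
  IsUpperBound P u = ∀ {x} → x ∈ P → x ≤ u

  field
    complete : (P : Pred Carrier 0ℓ) → Satisfiable P → Satisfiable (IsUpperBound P) →
               ∃ λ s → IsUpperBound P s × (∀ {u} → IsUpperBound P u → s ≤ u)

  commutativeRing : CommutativeRing 0ℓ 0ℓ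
  commutativeRing = record { isCommutativeRing = isCommutativeRing }

  decTotalOrder : DecTotalOrder 0ℓ 0ℓ 0ℓ
  decTotalOrder = record { isDecTotalOrder = isDecTotalOrder }

module RealProperties (ℝ : CompleteOrderedField) where
  open CompleteOrderedField ℝ public
  open CommutativeRing commutativeRing public
    using (setoid; refl; sym; trans; +-cong; +-congˡ; +-congʳ; *-cong; *-congˡ; *-congʳ;
           +-identityˡ; +-identityʳ; *-identityˡ; *-identityʳ; +-assoc; +-comm; *-assoc;
           *-comm; -‿inverseˡ; -‿inverseʳ; zeroˡ; zeroʳ; distribˡ; distribʳ; semiring;
           commutativeSemiring; +-group; ring)
  open DecTotalOrder decTotalOrder public
    using (total; _≤?_; _≟_; antisym; totalOrder)
    renaming (reflexive to ≤-reflexive; refl to ≤-refl; trans to ≤-trans)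
  open import Algebra.Construct.NaturalChoice.Max totalOrder public using (_⊔_)
  open import Algebra.Properties.Semiring.Mult semiring public
    using () renaming (_×_ to _·_)
  open import Algebra.Properties.Group +-group public using (∙-cancelˡ)
  open import Algebra.Properties.Ring ring public using (-‿distribˡ-*; -‿distribʳ-*)
  open import Algebra.Solver.Ring.NaturalCoefficients.Default commutativeSemiring

  infixl 6 _-_
  _-_ : Op₂ Carrier
  x - y = x + - y

  ∣_∣ : Op₁ Carrier
  ∣ x ∣ = x ⊔ - x

  ≤-respʳ : ∀ {x y z} → y ≈ z → x ≤ y → x ≤ z
  ≤-respʳ e p = ≤-trans p (≤-reflexive e)

  ≤-respˡ : ∀ {x y z} → x ≈ y → x ≤ z → y ≤ z
  ≤-respˡ e p = ≤-trans (≤-reflexive (sym e)) p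

  x≤x+d : ∀ {x d} → 0# ≤ d → x ≤ x + d
  x≤x+d 0≤d = ≤-respˡ (+-identityʳ _) (+-monoʳ-≤ _ 0≤d)

  +-nonneg : ∀ {x y} → 0# ≤ x → 0# ≤ y → 0# ≤ x + y
  +-nonneg 0≤x 0≤y = ≤-trans 0≤x (x≤x+d 0≤y)

  +-cancelˡ-≤ : ∀ x {y z} → x + y ≤ x + z → y ≤ z
  +-cancelˡ-≤ x p = ≤-respˡ (lem _) (≤-respʳ (lem _) (+-monoʳ-≤ (- x) p))
    where
    lem : ∀ y → - x + (x + y) ≈ y
    lem y = trans (sym (+-assoc _ _ _)) (trans (+-congʳ (-‿inverseˡ x)) (+-identityˡ y))

  ≤⇒∃ : ∀ {x y} → x ≤ y → ∃ λ d → 0# ≤ d × y ≈ x + d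
  ≤⇒∃ {x} {y} x≤y = - x + y
    , ≤-respˡ (-‿inverseˡ x) (+-monoʳ-≤ (- x) x≤y)
    , sym (trans (sym (+-assoc _ _ _)) (trans (+-congʳ (-‿inverseʳ x)) (+-identityˡ y)))

  square-nonneg : ∀ x → 0# ≤ x * x
  square-nonneg x with total 0# x
  ... | inj₁ 0≤x = *-nonneg 0≤x 0≤x
  ... | inj₂ x≤0 = ≤-respʳ -x*-x≈x*x (*-nonneg 0≤-x 0≤-x)
    where
    open import Algebra.Properties.Group +-group using (⁻¹-involutive)
    0≤-x : 0# ≤ - x
    0≤-x = ≤-respˡ (-‿inverseˡ x) (≤-respʳ (+-identityʳ _) (+-monoʳ-≤ (- x) x≤0))
    -x*-x≈x*x : - x * - x ≈ x * x
    -x*-x≈x*x = trans (sym (-‿distribˡ-* x (- x)))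
      (trans (CommutativeRing.-‿cong commutativeRing (sym (-‿distribʳ-* x x))) (⁻¹-involutive (x * x)))

  0≤1 : 0# ≤ 1#
  0≤1 = ≤-respʳ (*-identityˡ 1#) (square-nonneg 1#)

  ⁻¹-nonneg : ∀ {x} → ¬ x ≈ 0# → 0# ≤ x → 0# ≤ x ⁻¹
  ⁻¹-nonneg {x} x≉0 0≤x = ≤-respʳ
    (trans (solve 2 (λ x y → x :* (y :* y) := (x :* y) :* y) refl x (x ⁻¹))
      (trans (*-congʳ (*-inverseʳ x≉0)) (*-identityˡ _)))
    (*-nonneg 0≤x (square-nonneg (x ⁻¹)))

  1+-≉0 : ∀ {x} → 0# ≤ x → ¬ 1# + x ≈ 0#
  1+-≉0 0≤x e = 1≉0 (antisym (≤-respʳ e (x≤x+d 0≤x)) 0≤1)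

  ·1-nonneg : ∀ n → 0# ≤ n · 1#
  ·1-nonneg zero    = ≤-refl
  ·1-nonneg (suc n) = +-nonneg 0≤1 (·1-nonneg n)

  square≈0⇒≈0 : ∀ {x} → x * x ≈ 0# → x ≈ 0#
  square≈0⇒≈0 {x} e with x ≟ 0#
  ... | yes x≈0 = x≈0
  ... | no  x≉0 = trans (sym (*-identityʳ x)) (trans (*-congˡ (sym (*-inverseʳ x≉0)))
                    (trans (sym (*-assoc _ _ _)) (trans (*-congʳ e) (zeroˡ _))))

  square-cancel-≤ : ∀ {x y} → 0# ≤ y → x * x ≤ y * y → x ≤ y
  square-cancel-≤ {x} {y} 0≤y x²≤y² with total x y
  ... | inj₁ x≤y = x≤y
  ... | inj₂ y≤x with ≤⇒∃ y≤x
  ...   | d , 0≤d , x≈y+d = ≤-reflexive (trans x≈y+d (trans (+-congˡ d≈0) (+-identityʳ y)))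
    where
    x² : x * x ≈ y * y + (d * d + (y * d + y * d))
    x² = trans (*-cong x≈y+d x≈y+d)
      (solve 2 (λ y d → (y :+ d) :* (y :+ d) := y :* y :+ (d :* d :+ (y :* d :+ y :* d))) refl y d)
    0≤yd = *-nonneg 0≤y 0≤d
    d²≤0 : d * d ≤ 0#
    d²≤0 = ≤-trans (x≤x+d (+-nonneg 0≤yd 0≤yd))
      (+-cancelˡ-≤ (y * y) (≤-respˡ x² (≤-respʳ (sym (+-identityʳ _)) x²≤y²)))
    d≈0 : d ≈ 0#
    d≈0 = square≈0⇒≈0 (antisym d²≤0 (square-nonneg d))

  module SquareRoot {s : Carrier} (0≤s : 0# ≤ s) where

    Below : Pred Carrier 0ℓ
    Below x = x * x ≤ s

    0∈Below : 0# ∈ Below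
    0∈Below = ≤-respˡ (sym (zeroˡ 0#)) 0≤s

    1+s-upper : IsUpperBound Below (1# + s)
    1+s-upper x²≤s = square-cancel-≤ (+-nonneg 0≤1 0≤s) (≤-trans x²≤s (≤-respʳ
      (solve 1 (λ s → s :+ (con 1 :+ (s :+ s :* s)) := (con 1 :+ s) :* (con 1 :+ s)) refl s)
      (x≤x+d (+-nonneg 0≤1 (+-nonneg 0≤s (square-nonneg s))))))

    module Supremum {r} (upper : IsUpperBound Below r)
                    (least : ∀ {u} → IsUpperBound Below u → r ≤ u) where

      0≤r : 0# ≤ r
      0≤r = upper 0∈Below

      r²≤s : r * r ≤ s
      r²≤s with total (r * r) s | r ≟ 0#
      ... | inj₁ r²≤s | _       = r²≤s
      ... | inj₂ _    | yes r≈0 = ≤-respˡ (sym (*-cong r≈0 r≈0)) 0∈Below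
      ... | inj₂ s≤r² | no r≉0  with ≤⇒∃ s≤r²
      ...   | d , 0≤d , r²≈s+d = ≤-reflexive (trans r²≈s+d (trans (+-congˡ d≈0) (+-identityʳ s)))
        where
        2r≉0 : ¬ r + r ≈ 0#
        2r≉0 e = r≉0 (antisym (≤-respʳ e (x≤x+d 0≤r)) 0≤r)
        t = (r + r) ⁻¹
        0≤t = ⁻¹-nonneg 2r≉0 (+-nonneg 0≤r 0≤r)
        e = d * t
        u = r - e
        2re≈d : (r + r) * e ≈ d
        2re≈d = trans (solve 3 (λ k d t → k :* (d :* t) := d :* (k :* t)) refl (r + r) d t)
                  (trans (*-congˡ (*-inverseʳ 2r≉0)) (*-identityʳ d))
        u+e≈r : u + e ≈ r
        u+e≈r = trans (+-assoc _ _ _) (trans (+-congˡ (-‿inverseˡ e)) (+-identityʳ r))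
        2ru≈ : (r + r) * u ≈ r * r + s
        2ru≈ = ∙-cancelˡ d _ _ (trans (+-congʳ (sym 2re≈d))
          (trans (sym (distribˡ _ _ _)) (trans (*-congˡ (trans (+-comm e u) u+e≈r))
          (trans (distribʳ _ _ _) (trans (+-congˡ r²≈s+d)
          (solve 3 (λ a s d → a :+ (s :+ d) := d :+ (a :+ s)) refl (r * r) s d))))))
        0≤u : 0# ≤ u
        0≤u = ≤-respʳ (trans (*-congˡ (sym 2ru≈)) (trans
          (solve 3 (λ t k u → t :* (k :* u) := (k :* t) :* u) refl t (r + r) u)
          (trans (*-congʳ (*-inverseʳ 2r≉0)) (*-identityˡ u))))
          (*-nonneg 0≤t (+-nonneg (square-nonneg r) 0≤s))
        u²≈s+e² : u * u ≈ s + e * e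
        u²≈s+e² = ∙-cancelˡ d _ _ (trans
          (+-congʳ (trans (sym 2re≈d) (*-congʳ (+-cong (sym u+e≈r) (sym u+e≈r)))))
          (trans (solve 2 (λ u e → ((u :+ e) :+ (u :+ e)) :* e :+ u :* u
                                := (u :+ e) :* (u :+ e) :+ e :* e) refl u e)
          (trans (+-congʳ (trans (*-cong u+e≈r u+e≈r) r²≈s+d))
          (solve 3 (λ s d f → s :+ d :+ f := d :+ (s :+ f)) refl s d (e * e)))))
        r≤u : r ≤ u
        r≤u = least λ x²≤s → square-cancel-≤ 0≤u
          (≤-trans x²≤s (≤-respʳ (sym u²≈s+e²) (x≤x+d (square-nonneg e))))
        e≤0 : e ≤ 0#
        e≤0 = +-cancelˡ-≤ u (≤-respʳ (sym (+-identityʳ u)) (≤-respˡ (sym u+e≈r) r≤u))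
        d≈0 : d ≈ 0#
        d≈0 = trans (sym 2re≈d) (trans (*-congˡ (antisym e≤0 (*-nonneg 0≤d 0≤t))) (zeroʳ _))

      s≤r² : s ≤ r * r
      s≤r² with total s (r * r)
      ... | inj₁ s≤r² = s≤r²
      ... | inj₂ r²≤s with ≤⇒∃ r²≤s
      ...   | d , 0≤d , s≈r²+d = ≤-reflexive (trans s≈r²+d (trans (+-congˡ d≈0) (+-identityʳ _)))
        where
        k = 1# + (r + r + d)
        k≉0 = 1+-≉0 (+-nonneg (+-nonneg 0≤r 0≤r) 0≤d)
        t = k ⁻¹
        0≤t = ⁻¹-nonneg k≉0 (+-nonneg 0≤1 (+-nonneg (+-nonneg 0≤r 0≤r) 0≤d))
        e = d * t
        0≤e = *-nonneg 0≤d 0≤t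
        ke≈d : k * e ≈ d
        ke≈d = trans (solve 3 (λ k d t → k :* (d :* t) := d :* (k :* t)) refl k d t)
                 (trans (*-congˡ (*-inverseʳ k≉0)) (*-identityʳ d))
        f = t + ((r + r) * t + d)
        0≤f = +-nonneg 0≤t (+-nonneg (*-nonneg (+-nonneg 0≤r 0≤r) 0≤t) 0≤d)
        e+f≈1+d : e + f ≈ 1# + d
        e+f≈1+d = trans (solve 3 (λ r d t → d :* t :+ (t :+ ((r :+ r) :* t :+ d))
                                       := (con 1 :+ (r :+ r :+ d)) :* t :+ d) refl r d t)
                    (+-congʳ (*-inverseʳ k≉0))
        u = r + e
        s≈u²+ef : u * u + e * f ≈ s
        s≈u²+ef = trans (solve 3 (λ r e f → (r :+ e) :* (r :+ e) :+ e :* f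
                                         := r :* r :+ ((r :+ r) :* e :+ e :* (e :+ f))) refl r e f)
          (trans (+-congˡ (+-congˡ (*-congˡ e+f≈1+d)))
          (trans (+-congˡ (trans (solve 4 (λ w r e d → (r :+ r) :* e :+ e :* (w :+ d)
                                      := (w :+ (r :+ r :+ d)) :* e) refl 1# r e d) ke≈d))
          (sym s≈r²+d)))
        u≤r : u ≤ r
        u≤r = upper (≤-respʳ s≈u²+ef (x≤x+d (*-nonneg 0≤e 0≤f)))
        e≤0 : e ≤ 0#
        e≤0 = +-cancelˡ-≤ r (≤-respʳ (sym (+-identityʳ r)) u≤r)
        d≈0 : d ≈ 0#
        d≈0 = trans (sym ke≈d) (trans (*-congˡ (antisym e≤0 0≤e)) (zeroʳ _))

    supremum : ∃ λ r → IsUpperBound Below r × (∀ {u} → IsUpperBound Below u → r ≤ u)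
    supremum = complete Below (0# , 0∈Below) (1# + s , 1+s-upper)

    root : Carrier
    root = proj₁ supremum

    root-nonneg : 0# ≤ root
    root-nonneg = proj₁ (proj₂ supremum) 0∈Below

    root² : root * root ≈ s
    root² = antisym (Supremum.r²≤s (proj₁ (proj₂ supremum)) (proj₂ (proj₂ supremum)))
                    (Supremum.s≤r² (proj₁ (proj₂ supremum)) (proj₂ (proj₂ supremum)))

  √ : ∀ {s} → 0# ≤ s → Carrier
  √ 0≤s = SquareRoot.root 0≤s

------------------------------------------------------------------------
-- The hyperfields ℂ and 𝕍 and the map f.

module Viro (ℝ : CompleteOrderedField) where
  open RealProperties ℝ

  ℂ-setoid : Setoid 0ℓ 0ℓ
  ℂ-setoid = ×-setoid setoid setoid

  ℂ-rawRing : RawRing 0ℓ 0ℓ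
  ℂ-rawRing = record
    { Carrier = Setoid.Carrier ℂ-setoid
    ; _≈_     = Setoid._≈_ ℂ-setoid
    ; _+_     = λ (a , b) (c , d) → a + c , b + d
    ; _*_     = λ (a , b) (c , d) → a * c - b * d , a * d + b * c
    ; -_      = λ (a , b) → - a , - b
    ; 0#      = 0# , 0#
    ; 1#      = 1# , 0#
    }

  ℂ : RawHyperfield
  ℂ = fromRawRing ℂ-rawRing

  𝕍 : RawHyperfield
  𝕍 = record
    { Carrier = Σ Carrier (0# ≤_)
    ; _≈_     = λ (x , _) (y , _) → x ≈ y
    ; _⊞_     = λ (x , _) (y , _) (z , _) → ∣ x - y ∣ ≤ z × z ≤ x + y
    ; _*_     = λ (x , 0≤x) (y , 0≤y) → x * y , *-nonneg 0≤x 0≤y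
    ; -_      = λ x → x
    ; 0#      = 0# , ≤-refl
    ; 1#      = 1# , 0≤1
    }

  module ℂ = RawHyperfield ℂ
  module 𝕍 = RawHyperfield 𝕍
  module ℂ[T] = Polynomial ℂ
  module 𝕍[T] = Polynomial 𝕍

  f : ℂ.Carrier → 𝕍.Carrier
  f (x , y) = √ 0≤x²+y² , SquareRoot.root-nonneg 0≤x²+y²
    where
    0≤x²+y² : 0# ≤ x * x + y * y
    0≤x²+y² = +-nonneg (square-nonneg x) (square-nonneg y)

  Corresponds : ∀ {n} → ℂ[T].Poly n → 𝕍[T].Poly n → Set
  Corresponds p p̄ = ∀ i → f (ℂ[T].coeff p i) 𝕍.≈ 𝕍[T].coeff p̄ i

  -- IsFibreSum p a s says that s is the sum of mult_b(p) over all b with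
  -- f b = a: the list `support` contains every such b with nonzero
  -- multiplicity, and `mults` are the multiplicities of its entries.
  record IsFibreSum {n} (p : ℂ[T].Poly n) (a : 𝕍.Carrier) (s : ℕ) : Set where
    open Membership ℂ-setoid using (_∉_)
    open Uniqueness ℂ-setoid using (Unique)
    field
      support  : List ℂ.Carrier
      distinct : Unique support
      inFibre  : All (λ b → f b 𝕍.≈ a) support
      mults    : List ℕ
      isMults  : Pointwise (λ b m → ℂ[T].IsMult b p m) support mults
      complete : ∀ b → f b 𝕍.≈ a → b ∉ support → ℂ[T].IsMult b p 0
      total    : sum mults ≡ s

  infixl 7 _/_
  _/_ : ℕ → (d : ℕ) → .{{ℕ.NonZero d}} → 𝕍.Carrier
  n / suc d = n · 1# * (suc d · 1#) ⁻¹
            , *-nonneg (·1-nonneg n)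
                (⁻¹-nonneg (1+-≉0 (·1-nonneg d)) (·1-nonneg (suc d)))

  0·8 : 𝕍.Carrier
  0·8 = 8 / 10

  -- T³ + 1.6 T² + 0.512
  p̄ : 𝕍[T].Poly 3
  p̄ = record
    { coeff   = 512 / 1000 Vector.∷ 𝕍.0# Vector.∷ 16 / 10 Vector.∷ 𝕍.1# Vector.∷ Vector.[]
    ; leading = 1≉0
    }

{-# OPTIONS --safe #-}

-- In 𝕍 the polynomial T³ + 2aT² + a³ lies in (T - a) ⊡ (T² + aT + a²), because
-- 0 ∈ a² ⊞ a² and 2a ∈ a ⊞ a; likewise T² + aT + a² ∈ (T - a) ⊡ (T + a).  So a
-- is a root as often as the degree allows.
--
-- Over ℂ, let c₃b³ + c₂b² + c₀ = 0 with |b| = a.  Then |c₃b + c₂| = |c₀|/|b|² = a,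
-- while |c₃b| = a and |c₂| = 2a.  The triangle with these sides is degenerate, so
-- b = - c₂/2c₃.  Hence at most one root lies in the fibre over a, and it is simple
-- because the derivative there is c₂b/2 ≠ 0.
module Submission where

open import Defs
open import Data.Nat using (_>_; _≥_)
open import Data.Product using (∃; _×_)
open import Relation.Nullary using (¬_)

open import Algebra.Bundles using (AbelianGroup; CommutativeRing; RawRing)
import Algebra.Construct.DirectProduct as DirectProduct
import Algebra.Properties.AbelianGroup as AbelianGroupProperties
import Algebra.Properties.Ring as RingProperties
import Algebra.Properties.Semiring.Mult.TCOptimised as SemiringMult
import Algebra.Solver.Ring as RingSolver
open import Algebra.Solver.Ring.AlmostCommutativeRing using (fromCommutativeRing; _-Raw-AlmostCommutative⟶_)
import Algebra.Solver.Ring.NaturalCoefficients.Default as NaturalCoefficients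
open import Data.Fin.Base using (toℕ)
open import Data.Fin.Patterns using (0F; 1F; 2F; 3F)
open import Data.List.Base using (List; []; _∷_; foldr; tabulate)
open import Data.List.Relation.Binary.Pointwise.Base using (Pointwise; []; _∷_)
open import Data.List.Relation.Unary.All using (All; []; _∷_)
open import Data.List.Relation.Unary.AllPairs.Core using ([]; _∷_)
open import Data.List.Relation.Unary.Any using (here)
import Data.List.Relation.Unary.Unique.Setoid as Uniqueness
open import Data.Maybe.Base using (Maybe; just; nothing)
open import Data.Nat.Base as ℕ using (ℕ; zero; suc; z≤n; s≤s)
open import Data.Nat.ListAction using (sum)
import Data.Nat.Properties as ℕ
open import Data.Product using (_,_; proj₁; proj₂)
open import Data.Sum.Base using (_⊎_; inj₁; inj₂)
import Data.Vec.Functional as Vector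
open import Level using (0ℓ)
open import Relation.Binary.PropositionalEquality.Core as ≡ using (_≡_)
open import Relation.Nullary.Decidable.Core using (yes; no; _×-dec_)
open import Relation.Nullary.Negation.Core using (contradiction)
open import Relation.Unary using (_∈_)

-- The ring solver with coefficients in ℕ × ℕ, the pair (m , n) standing for
-- the integer m - n: unlike the carrier of an abstract ring, this has an
-- equality that computes, so that opposite terms cancel.
module DifferenceSolver (R : CommutativeRing 0ℓ 0ℓ) where
  open CommutativeRing R
  -- With this multiple `1 · 1#` reduces to `1#` itself, so `con (1 , 0)` matches a literal `1#` and
  -- `1-homo` is `refl`.
  open SemiringMult semiring using (×-homo-+; ×1-homo-*) renaming (_×_ to _·_)
  open RingProperties ring using (-‿distribˡ-*; -‿distribʳ-*; -0#≈0#)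
  open AbelianGroupProperties +-abelianGroup using (⁻¹-∙-comm; ⁻¹-involutive)
  open NaturalCoefficients commutativeSemiring using (_:+_; _:*_; _:=_) renaming (solve to solveℕ)
  open import Relation.Binary.Reasoning.Setoid setoid

  differences : RawRing 0ℓ 0ℓ
  differences = record
    { Carrier = ℕ × ℕ
    ; _≈_     = λ (m , n) (m′ , n′) → m ℕ.+ n′ ≡ m′ ℕ.+ n
    ; _+_     = λ (m , n) (m′ , n′) → m ℕ.+ m′ , n ℕ.+ n′
    ; _*_     = λ (m , n) (m′ , n′) → m ℕ.* m′ ℕ.+ n ℕ.* n′ , m ℕ.* n′ ℕ.+ n ℕ.* m′
    ; -_      = λ (m , n) → n , m
    ; 0#      = 0 , 0
    ; 1#      = 1 , 0
    }

  -‿+-homo : ∀ a b c d → (a + c) - (b + d) ≈ (a - b) + (c - d)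
  -‿+-homo a b c d = trans (+-congˡ (sym (⁻¹-∙-comm b d)))
    (solveℕ 4 (λ a b c d → (a :+ c) :+ (b :+ d) := (a :+ b) :+ (c :+ d)) refl a (- b) c (- d))

  -‿*-homo : ∀ a b c d → (a * c + b * d) - (a * d + b * c) ≈ (a - b) * (c - d)
  -‿*-homo a b c d = begin
    (a * c + b * d) - (a * d + b * c)
      ≈⟨ +-cong (+-congˡ (sym (trans (trans (sym (-‿distribˡ-* b (- d)))
           (-‿cong (sym (-‿distribʳ-* b d)))) (⁻¹-involutive _))))
           (trans (sym (⁻¹-∙-comm _ _)) (+-cong (-‿distribʳ-* a d) (-‿distribˡ-* b c))) ⟩
    (a * c + - b * - d) + (a * - d + - b * c)
      ≈⟨ solveℕ 4 (λ a b c d → (a :* c :+ b :* d) :+ (a :* d :+ b :* c) := (a :+ b) :* (c :+ d)) refl a (- b) c (- d) ⟩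
    (a - b) * (c - d) ∎

  -- Equal differences evaluate to the same term, since the solver compares
  -- normal forms up to definitional equality.
  ⟦_⟧ᵈ : ℕ × ℕ → Carrier
  ⟦ m , zero ⟧ᵈ      = m · 1#
  ⟦ zero , suc n ⟧ᵈ  = - (suc n · 1#)
  ⟦ suc m , suc n ⟧ᵈ = ⟦ m , n ⟧ᵈ

  -- Each cancelled pair of units contributes `1# - 1#`, which is zero. The homomorphism laws are
  -- thereby reduced to laws of plain differences.
  ⟦⟧ᵈ≈ : ∀ m n → ⟦ m , n ⟧ᵈ ≈ m · 1# - n · 1#
  ⟦⟧ᵈ≈ m       zero    = sym (trans (+-congˡ -0#≈0#) (+-identityʳ _))
  ⟦⟧ᵈ≈ zero    (suc n) = sym (+-identityˡ _)
  ⟦⟧ᵈ≈ (suc m) (suc n) = begin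
    ⟦ m , n ⟧ᵈ                       ≈⟨ ⟦⟧ᵈ≈ m n ⟩
    m · 1# - n · 1#                  ≈⟨ +-identityˡ _ ⟨
    0# + (m · 1# - n · 1#)           ≈⟨ +-congʳ (-‿inverseʳ 1#) ⟨
    (1# - 1#) + (m · 1# - n · 1#)    ≈⟨ -‿+-homo 1# 1# _ _ ⟨
    (1# + m · 1#) - (1# + n · 1#)    ≈⟨ +-cong (×-homo-+ 1# 1 m) (-‿cong (×-homo-+ 1# 1 n)) ⟨
    suc m · 1# - suc n · 1#          ∎

  private
    homomorphism : differences -Raw-AlmostCommutative⟶ fromCommutativeRing R
    homomorphism = record
      { ⟦_⟧    = ⟦_⟧ᵈ
      ; +-homo = λ (m , n) (m′ , n′) → begin
          ⟦ m ℕ.+ m′ , n ℕ.+ n′ ⟧ᵈ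
            ≈⟨ ⟦⟧ᵈ≈ (m ℕ.+ m′) (n ℕ.+ n′) ⟩
          (m ℕ.+ m′) · 1# - (n ℕ.+ n′) · 1#
            ≈⟨ +-cong (×-homo-+ 1# m m′) (-‿cong (×-homo-+ 1# n n′)) ⟩
          (m · 1# + m′ · 1#) - (n · 1# + n′ · 1#)
            ≈⟨ -‿+-homo _ _ _ _ ⟩
          (m · 1# - n · 1#) + (m′ · 1# - n′ · 1#)
            ≈⟨ +-cong (⟦⟧ᵈ≈ m n) (⟦⟧ᵈ≈ m′ n′) ⟨
          ⟦ m , n ⟧ᵈ + ⟦ m′ , n′ ⟧ᵈ ∎
      ; *-homo = λ (m , n) (m′ , n′) → begin
          ⟦ m ℕ.* m′ ℕ.+ n ℕ.* n′ , m ℕ.* n′ ℕ.+ n ℕ.* m′ ⟧ᵈ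
            ≈⟨ ⟦⟧ᵈ≈ (m ℕ.* m′ ℕ.+ n ℕ.* n′) (m ℕ.* n′ ℕ.+ n ℕ.* m′) ⟩
          (m ℕ.* m′ ℕ.+ n ℕ.* n′) · 1# - (m ℕ.* n′ ℕ.+ n ℕ.* m′) · 1#
            ≈⟨ +-cong (homo² m m′ n n′) (-‿cong (homo² m n′ n m′)) ⟩
          (m · 1# * m′ · 1# + n · 1# * n′ · 1#) - (m · 1# * n′ · 1# + n · 1# * m′ · 1#)
            ≈⟨ -‿*-homo _ _ _ _ ⟩
          (m · 1# - n · 1#) * (m′ · 1# - n′ · 1#)
            ≈⟨ *-cong (⟦⟧ᵈ≈ m n) (⟦⟧ᵈ≈ m′ n′) ⟨
          ⟦ m , n ⟧ᵈ * ⟦ m′ , n′ ⟧ᵈ ∎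
      ; -‿homo = λ (m , n) → begin
          ⟦ n , m ⟧ᵈ                    ≈⟨ ⟦⟧ᵈ≈ n m ⟩
          n · 1# - m · 1#               ≈⟨ +-congʳ (⁻¹-involutive _) ⟨
          - - (n · 1#) - m · 1#         ≈⟨ +-comm _ _ ⟩
          - (m · 1#) + - - (n · 1#)     ≈⟨ ⁻¹-∙-comm _ _ ⟩
          - (m · 1# - n · 1#)           ≈⟨ -‿cong (⟦⟧ᵈ≈ m n) ⟨
          - ⟦ m , n ⟧ᵈ                  ∎
      ; 0-homo = refl
      ; 1-homo = refl
      }
      where
      homo² : ∀ k l m n → (k ℕ.* l ℕ.+ m ℕ.* n) · 1# ≈ k · 1# * l · 1# + m · 1# * n · 1#
      homo² k l m n = trans (×-homo-+ 1# (k ℕ.* l) (m ℕ.* n)) (+-cong (×1-homo-* k l) (×1-homo-* m n))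

    -- The answer `nothing` makes no claim: in positive characteristic, different integers can have
    -- equal images.
    _≟ᵈ_ : ∀ x y → Maybe (⟦ x ⟧ᵈ ≈ ⟦ y ⟧ᵈ)
    (m , n) ≟ᵈ (m′ , n′) with m ℕ.+ n′ ℕ.≟ m′ ℕ.+ n
    ... | no  _ = nothing
    ... | yes e = just (begin
      ⟦ m , n ⟧ᵈ                                ≈⟨ ⟦⟧ᵈ≈ m n ⟩
      m · 1# - n · 1#                           ≈⟨ +-identityʳ _ ⟨
      -- Inserting `n′ - n′` creates the cross sum `m + n′`, which is what `e` can rewrite.
      (m · 1# - n · 1#) + 0#                    ≈⟨ +-congˡ (-‿inverseʳ (n′ · 1#)) ⟨
      (m · 1# - n · 1#) + (n′ · 1# - n′ · 1#)   ≈⟨ -‿+-homo _ _ _ _ ⟨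
      (m · 1# + n′ · 1#) - (n · 1# + n′ · 1#)   ≈⟨ +-cong cross (-‿cong (+-comm _ _)) ⟩
      (m′ · 1# + n · 1#) - (n′ · 1# + n · 1#)   ≈⟨ -‿+-homo _ _ _ _ ⟩
      (m′ · 1# - n′ · 1#) + (n · 1# - n · 1#)   ≈⟨ +-congˡ (-‿inverseʳ (n · 1#)) ⟩
      (m′ · 1# - n′ · 1#) + 0#                  ≈⟨ +-identityʳ _ ⟩
      m′ · 1# - n′ · 1#                         ≈⟨ ⟦⟧ᵈ≈ m′ n′ ⟨
      ⟦ m′ , n′ ⟧ᵈ                              ∎)
      where
      cross : m · 1# + n′ · 1# ≈ m′ · 1# + n · 1#
      cross = trans (sym (×-homo-+ 1# m n′)) (trans (reflexive (≡.cong (_· 1#) e)) (×-homo-+ 1# m′ n))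

  open RingSolver differences (fromCommutativeRing R) homomorphism _≟ᵈ_ public
    using (solve; con; _:+_; _:*_; _:-_; :-_; _:=_)

-- Multiplicity over an arbitrary hyperfield

module MultiplicityProperties (F : RawHyperfield) where
  open RawHyperfield F
  open Polynomial F

  -- Each unit of multiplicity splits off a linear factor and lowers the degree by one.
  mult≤degree : ∀ {n a k} (p : Poly n) → IsMult a p k → k ℕ.≤ n
  mult≤degree {k = zero}          p _                      = z≤n
  mult≤degree {suc n} {k = suc k} p (_ , (q , _ , h) , _) = s≤s (mult≤degree q h)

  -- Being a root separates zero from positive values, and two positive values are successors of
  -- maxima of the same set.
  mult-unique : ∀ {n a k l} (p : Poly n) → IsMult a p k → IsMult a p l → k ≡ l
  mult-unique {k = zero}  {zero}          p _ _ = ≡.refl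
  mult-unique {suc n} {k = zero}  {suc l} p ¬r (r , _) = contradiction r ¬r
  mult-unique {suc n} {k = suc k} {zero}  p (r , _) ¬r = contradiction r ¬r
  mult-unique {suc n} {k = suc k} {suc l} p (_ , k∈ , ≤k) (_ , l∈ , ≤l) =
    ≡.cong suc (ℕ.≤-antisym (≤l k k∈) (≤k l l∈))

  -- Every competing quotient has degree `n`, so the degree bound supplies maximality and a single
  -- extremal factorisation suffices.
  mult≡degree : ∀ {n a} (p : Poly (suc n)) (q : Poly n) → IsRoot a p →
                coeff p ∈ (T- a) ⊡ coeff q → IsMult a q n → IsMult a p (suc n)
  mult≡degree p q r p∈ h = r , (q , p∈ , h) , λ { _ (q′ , _ , h′) → mult≤degree q′ h′ }

-- Cubics over a commutative ring: evaluation, division and simple roots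

module CubicOverRing (R : CommutativeRing 0ℓ 0ℓ) where
  open CommutativeRing R hiding (zero)
  open DifferenceSolver R
  open RawHyperfield (fromRawRing rawRing) using (hypersum; _^_)
  open Polynomial (fromRawRing rawRing)
  open MultiplicityProperties (fromRawRing rawRing)
  open import Relation.Binary.Reasoning.Setoid setoid

  -- Hypersums in a ring are singletons. With the converse below, this turns roots and
  -- factorisations into ring equations.
  hypersum⇒≈ : ∀ xs {z} → z ∈ hypersum xs → z ≈ foldr _+_ 0# xs
  hypersum⇒≈ []       e            = e
  hypersum⇒≈ (x ∷ xs) (y , y∈ , e) = trans e (+-congˡ (hypersum⇒≈ xs y∈))

  ≈⇒hypersum : ∀ xs {z} → z ≈ foldr _+_ 0# xs → z ∈ hypersum xs
  ≈⇒hypersum []       e = e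
  ≈⇒hypersum (x ∷ xs) e = foldr _+_ 0# xs , ≈⇒hypersum xs refl , e

  evalTerms : ∀ {n} → Poly n → Carrier → List Carrier
  evalTerms p b = tabulate λ i → coeff p i * b ^ toℕ i

  ⊡⇒≈ : ∀ {n m} (c : Coeffs n) (d : Coeffs m) {e} → e ∈ c ⊡ d →
        ∀ i → e i ≈ foldr _+_ 0# (convolution c d (toℕ i))
  ⊡⇒≈ c d e∈ i = hypersum⇒≈ (convolution c d (toℕ i)) (e∈ i)

  ≈⇒⊡ : ∀ {n m} (c : Coeffs n) (d : Coeffs m) {e} →
        (∀ i → e i ≈ foldr _+_ 0# (convolution c d (toℕ i))) → e ∈ c ⊡ d
  ≈⇒⊡ c d e≈ i = ≈⇒hypersum (convolution c d (toℕ i)) (e≈ i)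

  eval₂ : Poly 2 → Carrier → Carrier
  eval₂ q b = coeff q 0F + coeff q 1F * b + coeff q 2F * (b * b)

  eval₃ : Poly 3 → Carrier → Carrier
  eval₃ p b = coeff p 0F + coeff p 1F * b + coeff p 2F * (b * b)
            + coeff p 3F * (b * b * b)

  derivative₃ : Poly 3 → Carrier → Carrier
  derivative₃ p b = coeff p 1F + (c₂ + c₂) * b + (c₃ + c₃ + c₃) * (b * b)
    where
    c₂ = coeff p 2F
    c₃ = coeff p 3F

  eval₂-sum : ∀ b (q : Poly 2) → foldr _+_ 0# (evalTerms q b) ≈ eval₂ q b
  eval₂-sum b q = solve 4 (λ b q₀ q₁ q₂ →
      -- The left side copies the unfolded fold literally, with the final `1#` of each power and the
      -- final `0#` of the sum.
      q₀ :* con (1 , 0) :+ (q₁ :* (b :* con (1 , 0)) :+ (q₂ :* (b :* (b :* con (1 , 0))) :+ con (0 , 0)))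
        := q₀ :+ q₁ :* b :+ q₂ :* (b :* b))
    refl b (coeff q 0F) (coeff q 1F) (coeff q 2F)

  eval₃-sum : ∀ b (p : Poly 3) → foldr _+_ 0# (evalTerms p b) ≈ eval₃ p b
  eval₃-sum b p = solve 5 (λ b p₀ p₁ p₂ p₃ →
      p₀ :* con (1 , 0) :+ (p₁ :* (b :* con (1 , 0)) :+ (p₂ :* (b :* (b :* con (1 , 0)))
        :+ (p₃ :* (b :* (b :* (b :* con (1 , 0)))) :+ con (0 , 0))))
        := p₀ :+ p₁ :* b :+ p₂ :* (b :* b) :+ p₃ :* (b :* b :* b))
    refl b (coeff p 0F) (coeff p 1F) (coeff p 2F) (coeff p 3F)

  root⇒eval₂≈0 : ∀ {b} (q : Poly 2) → IsRoot b q → eval₂ q b ≈ 0#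
  root⇒eval₂≈0 {b} q r = trans (sym (eval₂-sum b q)) (sym (hypersum⇒≈ (evalTerms q b) r))

  root⇒eval₃≈0 : ∀ {b} (p : Poly 3) → IsRoot b p → eval₃ p b ≈ 0#
  root⇒eval₃≈0 {b} p r = trans (sym (eval₃-sum b p)) (sym (hypersum⇒≈ (evalTerms p b) r))

  eval₃≈0⇒root : ∀ {b} (p : Poly 3) → eval₃ p b ≈ 0# → IsRoot b p
  eval₃≈0⇒root {b} p e = ≈⇒hypersum (evalTerms p b) (sym (trans (eval₃-sum b p) e))

  -- Differentiate p = (T - b) q at b.
  quotient-eval : ∀ b (p : Poly 3) (q : Poly 2) → coeff p ∈ (T- b) ⊡ coeff q →
                  eval₂ q b ≈ derivative₃ p b
  quotient-eval b p q p∈ = sym (trans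
    (+-cong (+-cong e₁ (*-congʳ (+-cong e₂ e₂))) (*-congʳ (+-cong (+-cong e₃ e₃) e₃)))
    (solve 4 (λ b q₀ q₁ q₂ →
        -- These are the unfolded convolutions of `T- b` with `q`; the constant coefficient is
        -- absent because differentiation removes it.
        let c₁ = :- b :* q₁ :+ (con (1 , 0) :* q₀ :+ con (0 , 0))
            c₂ = :- b :* q₂ :+ (con (1 , 0) :* q₁ :+ con (0 , 0))
            c₃ = con (1 , 0) :* q₂ :+ con (0 , 0)
        in c₁ :+ (c₂ :+ c₂) :* b :+ (c₃ :+ c₃ :+ c₃) :* (b :* b) := q₀ :+ q₁ :* b :+ q₂ :* (b :* b))
      refl b (coeff q 0F) (coeff q 1F) (coeff q 2F)))
    where
    e₁ = ⊡⇒≈ (T- b) (coeff q) p∈ 1F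
    e₂ = ⊡⇒≈ (T- b) (coeff q) p∈ 2F
    e₃ = ⊡⇒≈ (T- b) (coeff q) p∈ 3F

  horner : Carrier → Poly 3 → Poly 2
  horner b p = record
    { coeff   = (c₁ + b * (c₂ + b * c₃)) Vector.∷ (c₂ + b * c₃) Vector.∷ c₃ Vector.∷ Vector.[]
    ; leading = leading p
    }
    where
    c₁ = coeff p 1F
    c₂ = coeff p 2F
    c₃ = coeff p 3F

  -- Synthetic division leaves the remainder p(b), which affects only the constant coefficient; the
  -- other three agree identically.
  horner-factor : ∀ b (p : Poly 3) → eval₃ p b ≈ 0# → coeff p ∈ (T- b) ⊡ coeff (horner b p)
  horner-factor b p e = ≈⇒⊡ (T- b) (coeff (horner b p)) λ
    { 0F → trans
        (solve 5 (λ b c₀ c₁ c₂ c₃ → c₀ := c₀ :+ c₁ :* b :+ c₂ :* (b :* b) :+ c₃ :* (b :* b :* b)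
           :+ (:- b :* (c₁ :+ b :* (c₂ :+ b :* c₃)) :+ con (0 , 0))) refl b c₀ c₁ c₂ c₃)
        (trans (+-congʳ e) (+-identityˡ _))
    ; 1F → solve 4 (λ b c₁ c₂ c₃ →
        c₁ := :- b :* (c₂ :+ b :* c₃) :+ (con (1 , 0) :* (c₁ :+ b :* (c₂ :+ b :* c₃)) :+ con (0 , 0)))
        refl b c₁ c₂ c₃
    ; 2F → solve 3 (λ b c₂ c₃ →
        c₂ := :- b :* c₃ :+ (con (1 , 0) :* (c₂ :+ b :* c₃) :+ con (0 , 0))) refl b c₂ c₃
    ; 3F → 
        solve 1 (λ c₃ → c₃ := con (1 , 0) :* c₃ :+ con (0 , 0)) refl c₃
    }
    where
    c₀ = coeff p 0F
    c₁ = coeff p 1F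
    c₂ = coeff p 2F
    c₃ = coeff p 3F

  module _ {b : Carrier} (p : Poly 3) (p′≉0 : ¬ derivative₃ p b ≈ 0#) where

    -- Since q(b) = p′(b), no choice of quotient makes `b` a repeated root.
    quotient-nonroot : (q : Poly 2) → coeff p ∈ (T- b) ⊡ coeff q → ¬ IsRoot b q
    quotient-nonroot q p∈ r = p′≉0 (trans (sym (quotient-eval b p q p∈)) (root⇒eval₂≈0 q r))

    simple-mult≤1 : ∀ {m} → IsMult b p m → m ℕ.≤ 1
    simple-mult≤1 {zero}        _                              = z≤n
    simple-mult≤1 {suc zero}    _                              = s≤s z≤n
    simple-mult≤1 {suc (suc m)} (_ , (q , p∈ , (r , _)) , _) = contradiction r (quotient-nonroot q p∈)

    simple-root : IsRoot b p → IsMult b p 1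
    simple-root r =
        r
      -- All quotients have multiplicity 0 at `b`; Horner's shows that there is one, so the maximum
      -- is 0.
      , (horner b p , p∈ , quotient-nonroot (horner b p) p∈)
      , λ { zero    _                    → z≤n
          ; (suc m) (q , q∈ , (r′ , _)) → contradiction r′ (quotient-nonroot q q∈) }
      where
      p∈ = horner-factor b p (root⇒eval₃≈0 p r)

  eval₃-cong : ∀ {b b′} (p : Poly 3) → b ≈ b′ → eval₃ p b ≈ eval₃ p b′
  eval₃-cong p e = +-cong (+-cong (+-congˡ (*-congˡ e)) (*-congˡ (*-cong e e))) (*-congˡ (*-cong (*-cong e e) e))

  module _ {b : Carrier} (p : Poly 3) (c₁≈0 : coeff p 1F ≈ 0#) where
    private
      c₀ = coeff p 0F
      c₁ = coeff p 1F
      c₂ = coeff p 2F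
      c₃ = coeff p 3F

    -- Factoring b² out of the two top terms isolates `c₃ * b + c₂`, the triangle side whose length
    -- has to be computed.
    root-split : eval₃ p b ≈ 0# → b * b * (c₃ * b + c₂) ≈ - c₀
    root-split e = begin
      b * b * (c₃ * b + c₂)
        ≈⟨ solve 5 (λ b c₀ c₁ c₂ c₃ → b :* b :* (c₃ :* b :+ c₂)
             := (c₀ :+ c₁ :* b :+ c₂ :* (b :* b) :+ c₃ :* (b :* b :* b)) :- c₁ :* b :- c₀) refl b c₀ c₁ c₂ c₃ ⟩
      eval₃ p b - c₁ * b - c₀
        ≈⟨ +-congʳ (+-cong e (-‿cong (*-congʳ c₁≈0))) ⟩
      0# - 0# * b - c₀
        ≈⟨ solve 2 (λ b c₀ → con (0 , 0) :- con (0 , 0) :* b :- c₀ := :- c₀) refl b c₀ ⟩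
      - c₀ ∎

    -- Eliminate `c₃`: twice the derivative minus 3b times the midpoint expression leaves c₂b, up to
    -- the vanishing `c₁`.
    critical⇒ : c₂ + (c₃ + c₃) * b ≈ 0# → derivative₃ p b ≈ 0# → c₂ * b ≈ 0#
    critical⇒ m≈0 d≈0 = begin
      c₂ * b
        ≈⟨ solve 4 (λ b c₁ c₂ c₃ →
             let d = c₁ :+ (c₂ :+ c₂) :* b :+ (c₃ :+ c₃ :+ c₃) :* (b :* b)
                 m = c₂ :+ (c₃ :+ c₃) :* b
             in c₂ :* b := d :+ d :- (c₁ :+ c₁) :- con (3 , 0) :* b :* m) refl b c₁ c₂ c₃ ⟩
      derivative₃ p b + derivative₃ p b - (c₁ + c₁) - _ * b * (c₂ + (c₃ + c₃) * b)
        ≈⟨ +-cong (+-cong (+-cong d≈0 d≈0) (-‿cong (+-cong c₁≈0 c₁≈0))) (-‿cong (*-congˡ m≈0)) ⟩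
      0# + 0# - (0# + 0#) - _ * b * 0#
        ≈⟨ solve 1 (λ b → con (0 , 0) :+ con (0 , 0) :- (con (0 , 0) :+ con (0 , 0)) :- con (3 , 0) :* b :* con (0 , 0)
             := con (0 , 0)) refl b ⟩
      0# ∎

  -- This and the next identity give w + u and w - u for w = c₃b + c₂ and u = c₃b, as the
  -- parallelogram law requires.
  sum-of-halves : ∀ b c₂ c₃ → (c₃ * b + c₂) + c₃ * b ≈ c₂ + (c₃ + c₃) * b
  sum-of-halves = solve 3 (λ b c₂ c₃ → (c₃ :* b :+ c₂) :+ c₃ :* b := c₂ :+ (c₃ :+ c₃) :* b) refl

  difference-of-halves : ∀ b c₂ c₃ → (c₃ * b + c₂) - c₃ * b ≈ c₂
  difference-of-halves = solve 3 (λ b c₂ c₃ → (c₃ :* b :+ c₂) :- c₃ :* b := c₂) refl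

  linear-unique : ∀ {i k c b} → i * k ≈ 1# → c + k * b ≈ 0# → b ≈ i * - c
  linear-unique {i} {k} {c} {b} ik≈1 e = begin
    b                            ≈⟨ *-identityˡ b ⟨
    1# * b                       ≈⟨ *-congʳ ik≈1 ⟨
    i * k * b                    ≈⟨ solve 4 (λ i k c b → i :* k :* b := i :* (c :+ k :* b) :+ i :* :- c) refl i k c b ⟩
    i * (c + k * b) + i * - c    ≈⟨ +-congʳ (trans (*-congˡ e) (zeroʳ i)) ⟩
    0# + i * - c                 ≈⟨ +-identityˡ _ ⟩
    i * - c                      ∎

-- Real arithmetic and the constants 0.8, 1.6 and 0.512

module ViroProperties (ℝ : CompleteOrderedField) where
  open RealProperties ℝ
  open Viro ℝ
  open CommutativeRing commutativeRing using (-‿cong; +-abelianGroup)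
  open DifferenceSolver commutativeRing
  open import Algebra.Properties.Group +-group using (∙-cancelʳ)
  open import Algebra.Construct.NaturalChoice.Max totalOrder using (⊔-lub; x≤x⊔y)
  open import Algebra.Properties.Semiring.Mult semiring using (×-homo-+; ×1-homo-*)
  open import Relation.Binary.Reasoning.Setoid setoid

  *-cancelˡ : ∀ {x y z} → ¬ x ≈ 0# → x * y ≈ x * z → y ≈ z
  *-cancelˡ {x} {y} {z} x≉0 e = begin
    y              ≈⟨ cancel y ⟨
    x ⁻¹ * (x * y) ≈⟨ *-congˡ e ⟩
    x ⁻¹ * (x * z) ≈⟨ cancel z ⟩
    z              ∎
    where
    cancel : ∀ w → x ⁻¹ * (x * w) ≈ w
    cancel w = trans (solve 3 (λ x i w → i :* (x :* w) := (x :* i) :* w) refl x (x ⁻¹) w)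
                 (trans (*-congʳ (*-inverseʳ x≉0)) (*-identityˡ w))

  *-≉0 : ∀ {x y} → ¬ x ≈ 0# → ¬ y ≈ 0# → ¬ x * y ≈ 0#
  *-≉0 x≉0 y≉0 e = y≉0 (*-cancelˡ x≉0 (trans e (sym (zeroʳ _))))

  x+y≈0⇒x≈0 : ∀ {x y} → 0# ≤ x → 0# ≤ y → x + y ≈ 0# → x ≈ 0#
  x+y≈0⇒x≈0 0≤x 0≤y e = antisym (≤-respʳ e (x≤x+d 0≤y)) 0≤x

  x+x≈0⇒x≈0 : ∀ {x} → x + x ≈ 0# → x ≈ 0#
  x+x≈0⇒x≈0 {x} e = *-cancelˡ (1+-≉0 0≤1) (trans
    (solve 1 (λ x → (con (1 , 0) :+ con (1 , 0)) :* x := x :+ x) refl x) (trans e (sym (zeroʳ _))))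

  -- Clearing the denominator reduces an equation between decimals to one between natural numbers,
  -- which holds by computation.
  /-unique : ∀ {n d x} → x * (suc d · 1#) ≈ n · 1# → proj₁ (n / suc d) ≈ x
  /-unique {n} {d} {x} e = begin
    n · 1# * (suc d · 1#) ⁻¹         ≈⟨ *-congʳ e ⟨
    x * (suc d · 1#) * (suc d · 1#) ⁻¹ ≈⟨ *-assoc _ _ _ ⟩
    x * (suc d · 1# * (suc d · 1#) ⁻¹) ≈⟨ *-congˡ (*-inverseʳ (1+-≉0 (·1-nonneg d))) ⟩
    x * 1#                           ≈⟨ *-identityʳ x ⟩
    x                                ∎

  /-*-cancel : ∀ n d → proj₁ (n / suc d) * (suc d · 1#) ≈ n · 1#
  /-*-cancel n d = trans (solve 3 (λ n d i → n :* i :* d := n :* (d :* i)) refl (n · 1#) (suc d · 1#) ((suc d · 1#) ⁻¹))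
    (trans (*-congˡ (*-inverseʳ (1+-≉0 (·1-nonneg d)))) (*-identityʳ _))

  double-numerator : ∀ {m x} d → x * d ≈ m · 1# → (x + x) * d ≈ (m ℕ.+ m) · 1#
  double-numerator {m} d e = trans (distribʳ d _ _) (trans (+-cong e e) (sym (×-homo-+ 1# m m)))

  cube-fraction : ∀ {m d x} → x * (d · 1#) ≈ m · 1# →
                  x * x * x * ((d ℕ.* (d ℕ.* d)) · 1#) ≈ (m ℕ.* (m ℕ.* m)) · 1#
  cube-fraction {m} {d} {x} e = begin
    x * x * x * ((d ℕ.* (d ℕ.* d)) · 1#)
      ≈⟨ *-congˡ (cube d) ⟩
    x * x * x * (d · 1# * (d · 1# * d · 1#))
      ≈⟨ solve 2 (λ x d → x :* x :* x :* (d :* (d :* d)) := (x :* d) :* ((x :* d) :* (x :* d))) refl x (d · 1#) ⟩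
    x * (d · 1#) * (x * (d · 1#) * (x * (d · 1#)))
      ≈⟨ *-cong e (*-cong e e) ⟩
    m · 1# * (m · 1# * m · 1#)
      ≈⟨ cube m ⟨
    (m ℕ.* (m ℕ.* m)) · 1# ∎
    where
    cube : ∀ n → (n ℕ.* (n ℕ.* n)) · 1# ≈ n · 1# * (n · 1# * n · 1#)
    cube n = trans (×1-homo-* n (n ℕ.* n)) (*-congˡ (×1-homo-* n n))

  0·8≉0 : ¬ proj₁ 0·8 ≈ 0#
  0·8≉0 e = 1+-≉0 (·1-nonneg 7) (trans (sym (/-*-cancel 8 9)) (trans (*-congʳ e) (zeroˡ _)))

  1·6≈0·8+0·8 : proj₁ (16 / 10) ≈ proj₁ 0·8 + proj₁ 0·8
  -- The argument 9 is the predecessor of the denominator 10, and `8 + 8` computes to 16.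
  1·6≈0·8+0·8 = /-unique {16} {9} (double-numerator {8} (10 · 1#) (/-*-cancel 8 9))

  0·512≈0·8³ : proj₁ (512 / 1000) ≈ proj₁ 0·8 * proj₁ 0·8 * proj₁ 0·8
  -- Likewise 999 encodes 1000, which is 10 cubed, and 512 is 8 cubed.
  0·512≈0·8³ = /-unique {512} {999} (cube-fraction {8} {10} (/-*-cancel 8 9))

  -- The ring of complex numbers

  ℂ-commutativeRing : CommutativeRing 0ℓ 0ℓ
  ℂ-commutativeRing = record
    { isCommutativeRing = record
      { isRing = record
        { +-isAbelianGroup = AbelianGroup.isAbelianGroup (DirectProduct.abelianGroup +-abelianGroup +-abelianGroup)
        ; *-cong = λ (p , q) (r , s) → +-cong (*-cong p r) (-‿cong (*-cong q s)) , +-cong (*-cong p s) (*-cong q r)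
        ; *-assoc = λ (a , b) (c , d) (x , y) →
              solve 6 (λ a b c d x y → (a :* c :- b :* d) :* x :- (a :* d :+ b :* c) :* y
                := a :* (c :* x :- d :* y) :- b :* (c :* y :+ d :* x)) refl a b c d x y
            , solve 6 (λ a b c d x y → (a :* c :- b :* d) :* y :+ (a :* d :+ b :* c) :* x
                := a :* (c :* y :+ d :* x) :+ b :* (c :* x :- d :* y)) refl a b c d x y
        ; *-identity =
              (λ (a , b) → solve 2 (λ a b → con (1 , 0) :* a :- con (0 , 0) :* b := a) refl a b
                         , solve 2 (λ a b → con (1 , 0) :* b :+ con (0 , 0) :* a := b) refl a b)
            , (λ (a , b) → solve 2 (λ a b → a :* con (1 , 0) :- b :* con (0 , 0) := a) refl a b
                         , solve 2 (λ a b → a :* con (0 , 0) :+ b :* con (1 , 0) := b) refl a b)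
        ; distrib =
              (λ (a , b) (c , d) (x , y) →
                solve 6 (λ a b c d x y → a :* (c :+ x) :- b :* (d :+ y)
                  := (a :* c :- b :* d) :+ (a :* x :- b :* y)) refl a b c d x y
              , solve 6 (λ a b c d x y → a :* (d :+ y) :+ b :* (c :+ x)
                  := (a :* d :+ b :* c) :+ (a :* y :+ b :* x)) refl a b c d x y)
            , (λ (a , b) (c , d) (x , y) →
                solve 6 (λ a b c d x y → (c :+ x) :* a :- (d :+ y) :* b
                  := (c :* a :- d :* b) :+ (x :* a :- y :* b)) refl a b c d x y
              , solve 6 (λ a b c d x y → (c :+ x) :* b :+ (d :+ y) :* a
                  := (c :* b :+ d :* a) :+ (x :* b :+ y :* a)) refl a b c d x y)
        }
      ; *-comm = λ (a , b) (c , d) →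
            solve 4 (λ a b c d → a :* c :- b :* d := c :* a :- d :* b) refl a b c d
          , solve 4 (λ a b c d → a :* d :+ b :* c := c :* b :+ d :* a) refl a b c d
      }
    }

  module ℂR = CommutativeRing ℂ-commutativeRing

  -- The squared absolute value

  -- Unlike `f`, the square of the modulus is polynomial in the real and imaginary parts, so the
  -- ring solver can handle it.
  norm² : ℂ.Carrier → Carrier
  norm² (x , y) = x * x + y * y

  norm²-cong : ∀ z w → z ℂ.≈ w → norm² z ≈ norm² w
  norm²-cong z w (e , e′) = +-cong (*-cong e e) (*-cong e′ e′)

  norm²-nonneg : ∀ z → 0# ≤ norm² z
  norm²-nonneg (x , y) = +-nonneg (square-nonneg x) (square-nonneg y)

  -- This is the Brahmagupta-Fibonacci two-square identity.
  norm²-* : ∀ z w → norm² (z ℂ.* w) ≈ norm² z * norm² w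
  norm²-* (a , b) (c , d) = solve 4 (λ a b c d →
    (a :* c :- b :* d) :* (a :* c :- b :* d) :+ (a :* d :+ b :* c) :* (a :* d :+ b :* c)
      := (a :* a :+ b :* b) :* (c :* c :+ d :* d)) refl a b c d

  norm²-neg : ∀ z → norm² (ℂ.- z) ≈ norm² z
  norm²-neg (a , b) = solve 2 (λ a b → :- a :* :- a :+ :- b :* :- b := a :* a :+ b :* b) refl a b

  norm²-0 : norm² ℂ.0# ≈ 0#
  norm²-0 = solve 0 (con (0 , 0) :* con (0 , 0) :+ con (0 , 0) :* con (0 , 0) := con (0 , 0)) refl

  norm²≈0⇒≈0 : ∀ z → norm² z ≈ 0# → z ℂ.≈ ℂ.0#
  norm²≈0⇒≈0 (x , y) e =
      square≈0⇒≈0 (x+y≈0⇒x≈0 (square-nonneg x) (square-nonneg y) e)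
    , square≈0⇒≈0 (x+y≈0⇒x≈0 (square-nonneg y) (square-nonneg x) (trans (+-comm _ _) e))

  parallelogram : ∀ w u → norm² (w ℂR.+ u) + norm² (w ℂR.- u) ≈ (norm² w + norm² w) + (norm² u + norm² u)
  parallelogram (a , b) (c , d) = solve 4 (λ a b c d →
    ((a :+ c) :* (a :+ c) :+ (b :+ d) :* (b :+ d)) :+ ((a :- c) :* (a :- c) :+ (b :- d) :* (b :- d))
      := ((a :* a :+ b :* b) :+ (a :* a :+ b :* b)) :+ ((c :* c :+ d :* d) :+ (c :* c :+ d :* d))) refl a b c d

  ℂ-inverse : ℂ.Carrier → ℂ.Carrier
  ℂ-inverse z@(x , y) = x * norm² z ⁻¹ , - (y * norm² z ⁻¹)

  ℂ-inverseˡ : ∀ z → ¬ z ℂ.≈ ℂ.0# → ℂ-inverse z ℂ.* z ℂ.≈ ℂ.1#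
  ℂ-inverseˡ z@(x , y) z≉0 =
      trans (solve 3 (λ x y n → x :* n :* x :- :- (y :* n) :* y := (x :* x :+ y :* y) :* n) refl x y (norm² z ⁻¹))
            (*-inverseʳ λ e → z≉0 (norm²≈0⇒≈0 z e))
    , solve 3 (λ x y n → x :* n :* y :+ :- (y :* n) :* x := con (0 , 0)) refl x y (norm² z ⁻¹)

  f²≈norm² : ∀ z → proj₁ (f z) * proj₁ (f z) ≈ norm² z
  f²≈norm² z = SquareRoot.root² (norm²-nonneg z)

  f⇒norm² : ∀ z a → f z 𝕍.≈ a → norm² z ≈ proj₁ a * proj₁ a
  f⇒norm² z a e = trans (sym (f²≈norm² z)) (*-cong {proj₁ (f z)} {proj₁ a} {proj₁ (f z)} {proj₁ a} e e)

  -- Nonnegative reals are determined by their squares.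
  norm²⇒f : ∀ z a → norm² z ≈ proj₁ a * proj₁ a → f z 𝕍.≈ a
  norm²⇒f z a e = antisym {proj₁ (f z)} {proj₁ a}
    (square-cancel-≤ {proj₁ (f z)} {proj₁ a} (proj₂ a) (≤-reflexive f²≈a²))
    (square-cancel-≤ {proj₁ a} {proj₁ (f z)} (proj₂ (f z)) (≤-reflexive (sym f²≈a²)))
    where
    f²≈a² : proj₁ (f z) * proj₁ (f z) ≈ proj₁ a * proj₁ a
    f²≈a² = trans (f²≈norm² z) e

  -- Hypersums in 𝕍

  -- The absolute value is a maximum, so its bound splits into two linear ones: `x`, `y`, `z` are
  -- the sides of a possibly degenerate triangle.
  triangle⇒∈⊞ : ∀ x y z → proj₁ x ≤ proj₁ y + proj₁ z → proj₁ y ≤ proj₁ x + proj₁ z →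
                proj₁ z ≤ proj₁ x + proj₁ y → z ∈ x 𝕍.⊞ y
  triangle⇒∈⊞ (x , _) (y , _) (z , _) x≤y+z y≤x+z z≤x+y = ⊔-lub
      (+-cancelˡ-≤ y (≤-respˡ (solve 2 (λ x y → x := y :+ (x :- y)) refl x y) x≤y+z))
      (+-cancelˡ-≤ x (≤-respˡ (solve 2 (λ x y → y := x :+ :- (x :- y)) refl x y) y≤x+z))
    , z≤x+y

  ⊞-identityʳ : ∀ x y z → y 𝕍.≈ 𝕍.0# → x 𝕍.≈ z → z ∈ x 𝕍.⊞ y
  ⊞-identityʳ x y z y≈0 x≈z = triangle⇒∈⊞ x y z
    (≤-reflexive (trans x≈z (sym (trans (+-congʳ y≈0) (+-identityˡ _)))))
    (≤-respˡ (sym y≈0) (+-nonneg (proj₂ x) (proj₂ z)))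
    (≤-reflexive (trans (sym x≈z) (sym (trans (+-congˡ y≈0) (+-identityʳ _)))))

  ⊞-identityˡ : ∀ x y z → x 𝕍.≈ 𝕍.0# → y 𝕍.≈ z → z ∈ x 𝕍.⊞ y
  ⊞-identityˡ x y z x≈0 y≈z = triangle⇒∈⊞ x y z
    (≤-respˡ (sym x≈0) (+-nonneg (proj₂ y) (proj₂ z)))
    (≤-reflexive (trans y≈z (sym (trans (+-congʳ x≈0) (+-identityˡ _)))))
    (≤-reflexive (trans (sym y≈z) (sym (trans (+-congʳ x≈0) (+-identityˡ _)))))

  -- With equal legs the lower bound is zero, and only the upper one remains.
  ⊞-isosceles : ∀ x y z → x 𝕍.≈ y → proj₁ z ≤ proj₁ x + proj₁ y → z ∈ x 𝕍.⊞ y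
  ⊞-isosceles x y z x≈y z≤ = triangle⇒∈⊞ x y z
    (≤-respˡ (sym x≈y) (x≤x+d (proj₂ z))) (≤-respˡ x≈y (x≤x+d (proj₂ z))) z≤

  -- The triangle with sides 2z, z, z is collapsed, and z is the least element of 2z ⊞ z.
  ⊞-degenerate : ∀ x y z → proj₁ x ≈ proj₁ z + proj₁ z → y 𝕍.≈ z → z ∈ x 𝕍.⊞ y
  ⊞-degenerate x y z x≈2z y≈z = triangle⇒∈⊞ x y z
    (≤-reflexive (trans x≈2z (+-congʳ (sym y≈z))))
    (≤-respˡ (sym y≈z) z≤x+z)
    (≤-respʳ (+-congˡ (sym y≈z)) z≤x+z)
    where
    z≤x+z : proj₁ z ≤ proj₁ x + proj₁ z
    z≤x+z = ≤-respʳ (+-comm _ _) (x≤x+d (proj₂ x))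

  ∈hypersum₁ : ∀ x z → x 𝕍.≈ z → z ∈ 𝕍.hypersum (x ∷ [])
  ∈hypersum₁ x z x≈z = 𝕍.0# , refl , ⊞-identityʳ x 𝕍.0# z refl x≈z

  ∈hypersum₂ : ∀ x y z → z ∈ x 𝕍.⊞ y → z ∈ 𝕍.hypersum (x ∷ y ∷ [])
  ∈hypersum₂ x y z z∈ = y , ∈hypersum₁ y y refl , z∈

  -- Multiplicity three over 𝕍

  -- The coefficients are those of T³ + 2aT² + a³.
  module DegenerateCubic (a : 𝕍.Carrier) (p̄ : 𝕍[T].Poly 3)
    (c̄₀≈α³ : proj₁ (𝕍[T].coeff p̄ 0F) ≈ proj₁ a * proj₁ a * proj₁ a)
    (c̄₁≈0  : proj₁ (𝕍[T].coeff p̄ 1F) ≈ 0#)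
    (c̄₂≈2α : proj₁ (𝕍[T].coeff p̄ 2F) ≈ proj₁ a + proj₁ a)
    (c̄₃≈1  : proj₁ (𝕍[T].coeff p̄ 3F) ≈ 1#)
    where

    open 𝕍[T] using (coeff; IsMult; IsRoot; _⊡_; T-_)
    open MultiplicityProperties 𝕍

    α : Carrier
    α = proj₁ a

    a² a³ : 𝕍.Carrier
    a² = a 𝕍.* a
    a³ = a² 𝕍.* a

    q₀ : 𝕍[T].Poly 0
    q₀ = record { coeff = 𝕍.1# Vector.∷ Vector.[] ; leading = 1≉0 }

    q₁ : 𝕍[T].Poly 1
    q₁ = record { coeff = a Vector.∷ 𝕍.1# Vector.∷ Vector.[] ; leading = 1≉0 }

    q₂ : 𝕍[T].Poly 2
    q₂ = record { coeff = a² Vector.∷ a Vector.∷ 𝕍.1# Vector.∷ Vector.[] ; leading = 1≉0 }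

    α*1≈1*α : α * 1# ≈ 1# * α
    α*1≈1*α = *-comm α 1#

    α*1+1*α≈2α : α * 1# + 1# * α ≈ α + α
    α*1+1*α≈2α = +-cong (*-identityʳ α) (*-identityˡ α)

    α≤α*1+1*α : α ≤ α * 1# + 1# * α
    α≤α*1+1*α = ≤-respʳ (sym α*1+1*α≈2α) (x≤x+d (proj₂ a))

    q₁∈ : coeff q₁ ∈ (T- a) ⊡ coeff q₀
    q₁∈ 0F = ∈hypersum₁ (a 𝕍.* 𝕍.1#) a (*-identityʳ α)
    q₁∈ 1F = ∈hypersum₁ (𝕍.1# 𝕍.* 𝕍.1#) 𝕍.1# (*-identityʳ 1#)

    q₂∈ : coeff q₂ ∈ (T- a) ⊡ coeff q₁
    q₂∈ 0F = ∈hypersum₁ a² a² refl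
    q₂∈ 1F = ∈hypersum₂ (a 𝕍.* 𝕍.1#) (𝕍.1# 𝕍.* a) a
      (⊞-isosceles (a 𝕍.* 𝕍.1#) (𝕍.1# 𝕍.* a) a α*1≈1*α α≤α*1+1*α)
    q₂∈ 2F = ∈hypersum₁ (𝕍.1# 𝕍.* 𝕍.1#) 𝕍.1# (*-identityʳ 1#)

    p̄∈ : coeff p̄ ∈ (T- a) ⊡ coeff q₂
    p̄∈ 0F = ∈hypersum₁ (a 𝕍.* a²) (coeff p̄ 0F)
      (trans (solve 1 (λ α → α :* (α :* α) := α :* α :* α) refl α) (sym c̄₀≈α³))
    -- The linear coefficient can vanish because a² is its own hyperinverse.
    p̄∈ 1F = ∈hypersum₂ a² (𝕍.1# 𝕍.* a²) (coeff p̄ 1F)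
      (⊞-isosceles a² (𝕍.1# 𝕍.* a²) (coeff p̄ 1F) (sym (*-identityˡ _))
        (≤-respˡ (sym c̄₁≈0) (+-nonneg (proj₂ a²) (proj₂ (𝕍.1# 𝕍.* a²)))))
    -- Here 2a is the largest element of a ⊞ a.
    p̄∈ 2F = ∈hypersum₂ (a 𝕍.* 𝕍.1#) (𝕍.1# 𝕍.* a) (coeff p̄ 2F)
      (⊞-isosceles (a 𝕍.* 𝕍.1#) (𝕍.1# 𝕍.* a) (coeff p̄ 2F) α*1≈1*α
        (≤-reflexive (trans c̄₂≈2α (sym α*1+1*α≈2α))))
    p̄∈ 3F = ∈hypersum₁ (𝕍.1# 𝕍.* 𝕍.1#) (coeff p̄ 3F) (trans (*-identityʳ 1#) (sym c̄₃≈1))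

    q₁-root : IsRoot a q₁
    q₁-root = ∈hypersum₂ x y 𝕍.0#
      (⊞-isosceles x y 𝕍.0# (solve 1 (λ α → α :* con (1 , 0) := con (1 , 0) :* (α :* con (1 , 0))) refl α)
        (+-nonneg (proj₂ x) (proj₂ y)))
      where
      x = a 𝕍.* 𝕍.1#
      y = 𝕍.1# 𝕍.* (a 𝕍.* 𝕍.1#)

    q₂-root : IsRoot a q₂
    -- The two top terms both equal a², and a² is chosen from their hypersum so that it can cancel
    -- the constant term.
    q₂-root = a² , ∈hypersum₂ y z a²
        (⊞-isosceles y z a² (solve 1 (λ α → α :* (α :* con (1 , 0)) := con (1 , 0) :* (α :* (α :* con (1 , 0)))) refl α)
          (≤-respˡ (sym y≈a²) (x≤x+d (proj₂ z))))
      , ⊞-isosceles x a² 𝕍.0# (*-identityʳ _) (+-nonneg (proj₂ x) (proj₂ a²))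
      where
      x = a² 𝕍.* 𝕍.1#
      y = a 𝕍.* (a 𝕍.* 𝕍.1#)
      z = 𝕍.1# 𝕍.* (a 𝕍.* (a 𝕍.* 𝕍.1#))
      y≈a² : α * α ≈ α * (α * 1#)
      y≈a² = *-congˡ (sym (*-identityʳ α))

    -- The partial hypersums from the leading term down are all chosen as a³.
    p̄-root : IsRoot a p̄
    p̄-root =
        a³
      , (a³
        -- The top terms are 2a³ and a³, so a³ is the least element available.
        , ∈hypersum₂ w₂ w₃ a³ (⊞-degenerate w₂ w₃ a³
            (trans (*-congʳ c̄₂≈2α)
              (solve 1 (λ α → (α :+ α) :* (α :* (α :* con (1 , 0))) := α :* α :* α :+ α :* α :* α) refl α))
            (trans (*-congʳ c̄₃≈1)
              (solve 1 (λ α → con (1 , 0) :* (α :* (α :* (α :* con (1 , 0)))) := α :* α :* α) refl α)))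
        , ⊞-identityˡ w₁ a³ a³ (trans (*-congʳ c̄₁≈0) (zeroˡ _)) refl)
      , ⊞-isosceles w₀ a³ 𝕍.0# (trans (*-identityʳ _) c̄₀≈α³) (+-nonneg (proj₂ w₀) (proj₂ a³))
      where
      w₀ = coeff p̄ 0F 𝕍.* 𝕍.1#
      w₁ = coeff p̄ 1F 𝕍.* (a 𝕍.* 𝕍.1#)
      w₂ = coeff p̄ 2F 𝕍.* (a 𝕍.* (a 𝕍.* 𝕍.1#))
      w₃ = coeff p̄ 3F 𝕍.* (a 𝕍.* (a 𝕍.* (a 𝕍.* 𝕍.1#)))

    q₀-nonroot : ¬ IsRoot a q₀
    q₀-nonroot (y , y≈0 , ∣1*1-y∣≤0 , _) = 1≉0 (antisym
      (≤-respˡ 1*1-y≈1 (≤-trans (x≤x⊔y (1# * 1# - proj₁ y) _) ∣1*1-y∣≤0)) 0≤1)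
      where
      1*1-y≈1 : 1# * 1# - proj₁ y ≈ 1#
      1*1-y≈1 = trans (+-congˡ (-‿cong y≈0))
        (solve 0 (con (1 , 0) :* con (1 , 0) :- con (0 , 0) := con (1 , 0)) refl)

    p̄-mult : IsMult a p̄ 3
    p̄-mult = mult≡degree p̄ q₂ p̄-root p̄∈
      (mult≡degree q₂ q₁ q₂-root q₂∈
        (mult≡degree q₁ q₀ q₁-root q₁∈ q₀-nonroot))

    -- Roots of a corresponding complex cubic over `a`

    module Fibre (α≉0 : ¬ α ≈ 0#) (p : ℂ[T].Poly 3) (p↦p̄ : Corresponds p p̄) where
      open ℂ[T] using () renaming (IsRoot to IsRootℂ; IsMult to IsMultℂ)
      open CubicOverRing ℂ-commutativeRing
      open Uniqueness ℂ-setoid using (Unique)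

      c₀ c₁ c₂ c₃ b₀ : ℂ.Carrier
      c₀ = ℂ[T].coeff p 0F
      c₁ = ℂ[T].coeff p 1F
      c₂ = ℂ[T].coeff p 2F
      c₃ = ℂ[T].coeff p 3F
      b₀ = ℂ-inverse (c₃ ℂR.+ c₃) ℂ.* ℂ.- c₂

      norm²-coeff : ∀ i → norm² (ℂ[T].coeff p i) ≈ proj₁ (coeff p̄ i) * proj₁ (coeff p̄ i)
      norm²-coeff i = f⇒norm² (ℂ[T].coeff p i) (coeff p̄ i) (p↦p̄ i)

      norm²c₀ : norm² c₀ ≈ (α * α * α) * (α * α * α)
      norm²c₀ = trans (norm²-coeff 0F) (*-cong c̄₀≈α³ c̄₀≈α³)

      norm²c₂ : norm² c₂ ≈ (α + α) * (α + α)
      norm²c₂ = trans (norm²-coeff 2F) (*-cong c̄₂≈2α c̄₂≈2α)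

      norm²c₃ : norm² c₃ ≈ 1#
      norm²c₃ = trans (norm²-coeff 3F) (trans (*-cong c̄₃≈1 c̄₃≈1) (*-identityʳ 1#))

      c₁≈0 : c₁ ℂ.≈ ℂ.0#
      c₁≈0 = norm²≈0⇒≈0 c₁ (trans (norm²-coeff 1F) (trans (*-congʳ c̄₁≈0) (zeroˡ _)))

      2c₃≉0 : ¬ c₃ ℂR.+ c₃ ℂ.≈ ℂ.0#
      2c₃≉0 (e , e′) = 1≉0 (trans (sym norm²c₃) (trans (norm²-cong c₃ ℂ.0# (x+x≈0⇒x≈0 e , x+x≈0⇒x≈0 e′)) norm²-0))

      -- The triangle with vertices 0, c₃b and c₃b + c₂ has sides α, 2α and α,
      -- so it is degenerate and c₃b = - c₂/2.
      midpoint : ∀ b → f b 𝕍.≈ a → eval₃ p b ℂ.≈ ℂ.0# → c₂ ℂR.+ (c₃ ℂR.+ c₃) ℂR.* b ℂ.≈ ℂ.0#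
      midpoint b fb≈a e = norm²≈0⇒≈0 _ (trans
        (sym (norm²-cong (w ℂR.+ u) _ (sum-of-halves b c₂ c₃)))
        -- By the parallelogram law |w + u|² + |c₂|² = 2|w|² + 2|u|² = 4α². Since |c₂|² = 4α²,
        -- cancelling it leaves |w + u| = 0.
        (∙-cancelʳ ((α + α) * (α + α)) _ _ (begin
          norm² (w ℂR.+ u) + (α + α) * (α + α)
            ≈⟨ +-congˡ (trans (norm²-cong (w ℂR.- u) c₂ (difference-of-halves b c₂ c₃)) norm²c₂) ⟨
          norm² (w ℂR.+ u) + norm² (w ℂR.- u)
            ≈⟨ parallelogram w u ⟩
          (norm² w + norm² w) + (norm² u + norm² u)
            ≈⟨ +-cong (+-cong norm²w norm²w) (+-cong norm²u norm²u) ⟩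
          (α * α + α * α) + (α * α + α * α)
            ≈⟨ solve 1 (λ α → (α :* α :+ α :* α) :+ (α :* α :+ α :* α) := con (0 , 0) :+ (α :+ α) :* (α :+ α)) refl α ⟩
          0# + (α + α) * (α + α) ∎)))
        where
        u w : ℂ.Carrier
        u = c₃ ℂR.* b
        w = u ℂR.+ c₂
        norm²b : norm² b ≈ α * α
        norm²b = f⇒norm² b a fb≈a
        norm²u : norm² u ≈ α * α
        norm²u = trans (norm²-* c₃ b) (trans (*-cong norm²c₃ norm²b) (*-identityˡ _))
        norm²w : norm² w ≈ α * α
        -- From |b|⁴|w|² = |c₀|² = α⁶ and |b|⁴ = α⁴, cancel the nonzero factor α⁴.
        norm²w = *-cancelˡ (*-≉0 (*-≉0 α≉0 α≉0) (*-≉0 α≉0 α≉0)) (begin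
          α * α * (α * α) * norm² w
            ≈⟨ *-congʳ (*-cong norm²b norm²b) ⟨
          norm² b * norm² b * norm² w
            ≈⟨ *-congʳ (norm²-* b b) ⟨
          norm² (b ℂR.* b) * norm² w
            ≈⟨ norm²-* (b ℂR.* b) w ⟨
          norm² (b ℂR.* b ℂR.* w)
            ≈⟨ norm²-cong (b ℂR.* b ℂR.* w) (ℂ.- c₀) (root-split p c₁≈0 e) ⟩
          norm² (ℂ.- c₀)
            ≈⟨ trans (norm²-neg c₀) norm²c₀ ⟩
          (α * α * α) * (α * α * α)
            ≈⟨ solve 1 (λ α → (α :* α :* α) :* (α :* α :* α) := α :* α :* (α :* α) :* (α :* α)) refl α ⟩
          α * α * (α * α) * (α * α) ∎)

      root≈b₀ : ∀ b → f b 𝕍.≈ a → IsRootℂ b p → b ℂ.≈ b₀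
      root≈b₀ b fb≈a r = linear-unique
        {ℂ-inverse (c₃ ℂR.+ c₃)} {c₃ ℂR.+ c₃} {c₂} {b}
        (ℂ-inverseˡ _ 2c₃≉0) (midpoint b fb≈a (root⇒eval₃≈0 p r))

      -- A critical root would force c₂b = 0, whereas |c₂b|² = 4α⁴ is nonzero.
      derivative≉0 : ∀ b → f b 𝕍.≈ a → IsRootℂ b p → ¬ derivative₃ p b ℂ.≈ ℂ.0#
      derivative≉0 b fb≈a r d≈0 = *-≉0 (*-≉0 2α≉0 2α≉0) (*-≉0 α≉0 α≉0) (begin
        (α + α) * (α + α) * (α * α)   ≈⟨ *-cong norm²c₂ (f⇒norm² b a fb≈a) ⟨
        norm² c₂ * norm² b            ≈⟨ norm²-* c₂ b ⟨
        norm² (c₂ ℂ.* b)              ≈⟨ norm²-cong (c₂ ℂ.* b) ℂ.0#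
                                           (critical⇒ p c₁≈0 (midpoint b fb≈a (root⇒eval₃≈0 p r)) d≈0) ⟩
        norm² ℂ.0#                    ≈⟨ norm²-0 ⟩
        0#                            ∎)
        where
        2α≉0 : ¬ α + α ≈ 0#
        2α≉0 e = α≉0 (x+x≈0⇒x≈0 e)

      mult-in-fibre : ∀ b m → f b 𝕍.≈ a → IsMultℂ b p m → m ≡ 0 ⊎ m ≡ 1 × b ℂ.≈ b₀
      mult-in-fibre b zero    fb≈a h = inj₁ ≡.refl
      mult-in-fibre b (suc m) fb≈a h = inj₂
        ( ℕ.≤-antisym (simple-mult≤1 p (derivative≉0 b fb≈a (proj₁ h)) {suc m} h) (s≤s z≤n)
        , root≈b₀ b fb≈a (proj₁ h))

      -- Once a point equal to `b₀` has been listed, distinctness keeps `b₀` out of the remaining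
      -- entries, so they contribute nothing.
      mults-away : ∀ {b bs ms} → b ℂ.≈ b₀ → All (λ b′ → ¬ b ℂ.≈ b′) bs → All (λ b → f b 𝕍.≈ a) bs →
                   Pointwise (λ b m → IsMultℂ b p m) bs ms → sum ms ≡ 0
      mults-away b≈b₀ [] [] [] = ≡.refl
      mults-away {bs = b′ ∷ _} {m ∷ _} b≈b₀ (b≉b′ ∷ b≉) (fb′≈a ∷ fibre) (h ∷ hs)
        with mult-in-fibre b′ m fb′≈a h
      ... | inj₁ ≡.refl        = mults-away b≈b₀ b≉ fibre hs
      ... | inj₂ (_ , b′≈b₀) = contradiction (ℂR.trans b≈b₀ (ℂR.sym b′≈b₀)) b≉b′

      mults≤1 : ∀ {bs ms} → Unique bs → All (λ b → f b 𝕍.≈ a) bs →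
                Pointwise (λ b m → IsMultℂ b p m) bs ms → sum ms ℕ.≤ 1
      mults≤1 [] [] [] = z≤n
      mults≤1 {b ∷ _} {m ∷ _} (b≉ ∷ distinct) (fb≈a ∷ fibre) (h ∷ hs)
        with mult-in-fibre b m fb≈a h
      ... | inj₁ ≡.refl          = mults≤1 distinct fibre hs
      ... | inj₂ (≡.refl , b≈b₀) = ℕ.≤-reflexive (≡.cong suc (mults-away b≈b₀ b≉ fibre hs))

      fibreSum≤1 : ∀ {s} → IsFibreSum p a s → s ℕ.≤ 1
      fibreSum≤1 σ = ≡.subst (ℕ._≤ 1) (IsFibreSum.total σ) (mults≤1 distinct inFibre isMults)
        where open IsFibreSum σ using (distinct; inFibre; isMults)

      -- The only candidate for the support is `b₀`. Equality of reals is decidable, so it can be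
      -- tested for lying over `a` and being a root.
      fibreSum-exists : ∃ λ s → IsFibreSum p a s
      fibreSum-exists
        with norm² b₀ ≟ α * α ×-dec (proj₁ (eval₃ p b₀) ≟ 0# ×-dec proj₂ (eval₃ p b₀) ≟ 0#)
      ... | yes (n , e) = 1 , record
        { support  = b₀ ∷ []
        ; distinct = [] ∷ []
        ; inFibre  = fb₀≈a ∷ []
        ; mults    = 1 ∷ []
        ; isMults  = simple-root p (derivative≉0 b₀ fb₀≈a b₀-root) b₀-root ∷ []
        ; complete = λ b fb≈a b∉ r → b∉ (here (root≈b₀ b fb≈a r))
        ; total    = ≡.refl
        }
        where
        fb₀≈a = norm²⇒f b₀ a n
        b₀-root = eval₃≈0⇒root p e
      ... | no ¬b₀ = 0 , record
        { support  = []
        ; distinct = []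
        ; inFibre  = []
        ; mults    = []
        ; isMults  = []
        -- A root over `a` equals `b₀` and would transfer both tested properties to it.
        ; complete = λ b fb≈a _ r → let b≈b₀ = root≈b₀ b fb≈a r in ¬b₀
            ( trans (sym (norm²-cong b b₀ b≈b₀)) (f⇒norm² b a fb≈a)
            , ℂR.trans (ℂR.sym (eval₃-cong p b≈b₀)) (root⇒eval₃≈0 p r))
        ; total    = ≡.refl
        }

mainTheorem1 : (ℝ : CompleteOrderedField) → let open Viro ℝ in
    𝕍[T].IsMult 0·8 p̄ 3
    × (∀ (p : ℂ[T].Poly 3) → Corresponds p p̄ →
         ∃ λ s → IsFibreSum p 0·8 s × 3 > 2 × 2 ≥ s)
    × ¬ (∃ λ (p : ℂ[T].Poly 3) → Corresponds p p̄ ×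
         ∃ λ s → IsFibreSum p 0·8 s × 𝕍[T].IsMult 0·8 p̄ s)
mainTheorem1 ℝ =
    p̄-mult
  , (λ p p↦p̄ → let s , σ = fibreSum-exists p p↦p̄ in
      s , σ , ℕ.≤-refl , ℕ.m≤n⇒m≤1+n (fibreSum≤1 p p↦p̄ σ))
  , λ (p , p↦p̄ , s , σ , h) → contradiction
      -- Equality would make the fibre sum 3, by uniqueness of the multiplicity, although it is at
      -- most 1.
      (≡.subst (ℕ._≤ 1) (mult-unique p̄ h p̄-mult) (fibreSum≤1 p p↦p̄ σ))
      λ { (s≤s ()) }
  where
  open RealProperties ℝ using (refl)
  open Viro ℝ
  open ViroProperties ℝ
  open MultiplicityProperties 𝕍 using (mult-unique)
  open DegenerateCubic 0·8 p̄ 0·512≈0·8³ refl 1·6≈0·8+0·8 refl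
  open Fibre 0·8≉0 using (fibreSum-exists; fibreSum≤1)
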